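{- For any classical Undirected Geography position, its outcome class in classical Undirected Geography equals its outcome class as a position of Quantum Undirected Geography with quantum flavor D and superposition width $2$.
   Context: Undirected Geography: a position consists of an undirected graph $G=(V,E)$, a set of visited vertices, and a current vertex (the token's location, which is visited). A move is labelled by a vertex $v$; it is feasible iff $v$ is adjacent to the current vertex and unvisited, and it moves the token to $v$ and marks $v$ visited. The game is impartial; under normal play a player with no feasible move loses. Outcome classes: $\mathcal N$ (next player wins), $\mathcal P$ (previous player wins). Quantum lift with width $2$: a quantum move is $\langle v_1\mid v_2\rangle$ for distinct move labels; quantum positions are superpositions of distinct classical positions (realizations). A classical move $v$ maps $\langle b_1\mid\cdots\mid b_s\rangle$ to the superposition of the distinct results of $v$ over realizations where $v$ is feasible (others collapse); a quantum move $\langle v_1\mid v_2\rangle$ maps it to the superposition of distinct results of $v_j$ applied to $b_i$ over all feasible pairs. A quantum move is legal only if each of $v_1,v_2$ is feasible in some realization; a classical move is legal only if feasible in some realization. Flavor D: any legal classical or quantum move may be played; a player with no legal move loses. -}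

module Defs where

open import Data.Bool using (Bool; true; false; not; _∧_; T)
open import Data.Bool.Properties using () renaming (_≟_ to _≟B_)
open import Data.Nat using (ℕ)
open import Data.Fin using (Fin)
open import Data.Fin.Properties using () renaming (_≟_ to _≟F_)
open import Data.Vec using (Vec; lookup; _[_]≔_)
import Data.Vec.Properties as VecP
open import Data.Product using (_×_; _,_; proj₁; proj₂; Σ; ∃)
import Data.Product.Properties as ProdP
open import Data.List using (List; []; _∷_; filter; map; concatMap; deduplicate)
open import Data.List.Relation.Unary.Any using (Any)
open import Relation.Binary.PropositionalEquality using (_≡_)
open import Relation.Binary.Definitions using (DecidableEquality)
open import Relation.Nullary using (¬_)
open import Relation.Nullary.Decidable using (T?)

record Graph (n : ℕ) : Set where
  field
    adj   : Fin n → Fin n → Bool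
    sym   : ∀ u v → adj u v ≡ adj v u
    irrefl : ∀ v → adj v v ≡ false
open Graph public

-- A classical position (on a fixed graph): the visited set (as a
-- characteristic vector, true = visited) and the current vertex.
Pos : ℕ → Set
Pos n = Vec Bool n × Fin n

visited : ∀ {n} → Pos n → Vec Bool n
visited = proj₁

current : ∀ {n} → Pos n → Fin n
current = proj₂

IsPosition : ∀ {n} → Pos n → Set
IsPosition p = lookup (visited p) (current p) ≡ true

_≟P_ : ∀ {n} → DecidableEquality (Pos n)
_≟P_ = ProdP.≡-dec (VecP.≡-dec _≟B_) _≟F_

feasible : ∀ {n} → Graph n → Pos n → Fin n → Bool
feasible G p v = adj G (current p) v ∧ not (lookup (visited p) v)

play : ∀ {n} → Pos n → Fin n → Pos n
play p v = (visited p [ v ]≔ true) , v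

-- Classical Undirected Geography: outcome classes N and P (normal play),
-- defined inductively (the game is finite).

mutual
  data ClN {n} (G : Graph n) : Pos n → Set where
    clN : ∀ {p} (v : Fin n) → T (feasible G p v) → ClP G (play p v) → ClN G p

  data ClP {n} (G : Graph n) : Pos n → Set where
    clP : ∀ {p} → ((v : Fin n) → T (feasible G p v) → ClN G (play p v)) → ClP G p

-- Quantum Undirected Geography, width 2, flavor D.
-- A quantum position is a list of (distinct) classical realizations.

QPos : ℕ → Set
QPos n = List (Pos n)

dedup : ∀ {n} → List (Pos n) → List (Pos n)
dedup = deduplicate _≟P_

qClassical : ∀ {n} → Graph n → QPos n → Fin n → QPos n
qClassical G qs v = dedup (map (λ b → play b v) (filter (λ b → T? (feasible G b v)) qs))

step : ∀ {n} → Graph n → Fin n → Pos n → List (Pos n)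
step G v b with feasible G b v
... | true  = play b v ∷ []
... | false = []

qQuantum : ∀ {n} → Graph n → QPos n → Fin n → Fin n → QPos n
qQuantum G qs v₁ v₂ = dedup (concatMap (λ b → step G v₁ b Data.List.++ step G v₂ b) qs)

FeasibleSomewhere : ∀ {n} → Graph n → QPos n → Fin n → Set
FeasibleSomewhere G qs v = Any (λ b → T (feasible G b v)) qs

data QMove (n : ℕ) : Set where
  classical : Fin n → QMove n
  quantum   : (v₁ v₂ : Fin n) → ¬ (v₁ ≡ v₂) → QMove n

-- Legality (flavor D: any legal classical or quantum move).
Legal : ∀ {n} → Graph n → QPos n → QMove n → Set
Legal G qs (classical v)     = FeasibleSomewhere G qs v
Legal G qs (quantum v₁ v₂ _) = FeasibleSomewhere G qs v₁ × FeasibleSomewhere G qs v₂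

qApply : ∀ {n} → Graph n → QPos n → QMove n → QPos n
qApply G qs (classical v)      = qClassical G qs v
qApply G qs (quantum v₁ v₂ _)  = qQuantum G qs v₁ v₂

mutual
  data QN {n} (G : Graph n) : QPos n → Set where
    qN : ∀ {qs} (m : QMove n) → Legal G qs m → QP G (qApply G qs m) → QN G qs

  data QP {n} (G : Graph n) : QPos n → Set where
    qP : ∀ {qs} → ((m : QMove n) → Legal G qs m → QN G (qApply G qs m)) → QP G qs

{-# OPTIONS --safe #-}

-- Classically, the player to move loses iff every maximum matching of the
-- unvisited vertices covers all unvisited neighbours of the token; the other
-- player then wins by answering x with a partner of x in a maximum matching.
--
-- In the quantum game the winner answers with classical moves only.  The
-- superpositions this produces are products: the vertices fall into disjoint
-- classes, each class has exactly one unvisited vertex, and all choices of these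
-- vertices occur.  The invariant is that all realizations have the same maximum
-- matchings, seen as matchings of classes.  Suppose the opponent plays ⟨x∣y⟩ with
-- x, y in distinct classes C, D.  If some maximum matching pairs C with the class
-- of a vertex z not adjacent to y, then answering z collapses y away (and
-- symmetrically).  Otherwise C and D can trade partners in every maximum
-- matching, so after an answer z matched to C the classes C and D merge into one
-- class, and the transposition (C D) identifies the maximum matchings of the
-- realizations that went through x with those that went through y.

module Submission where

open import Defs hiding (sym)
open import Data.Bool using (Bool; true; false; not; _∧_; T; if_then_else_)
open import Data.Bool.Properties using (¬-not) renaming (_≟_ to _≟B_)
open import Data.Fin using (Fin; zero; suc)
open import Data.Fin.Permutation using () renaming (transpose to transposition)
open import Data.Fin.Permutation.Components using (transpose)
open import Data.Fin.Properties using (_≟_; any?; all?)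
open import Data.List using ([]; _∷_; _++_)
open import Data.List.Membership.Propositional using (_∈_; find; lose)
open import Data.List.Membership.Propositional.Properties
  using (∈-deduplicate⁺; ∈-deduplicate⁻; ∈-map⁺; ∈-map⁻; ∈-filter⁺; ∈-filter⁻;
         ∈-concatMap⁺; ∈-concatMap⁻; ∈-++⁺ˡ; ∈-++⁺ʳ; ∈-++⁻)
open import Data.List.Relation.Unary.Any using (here)
open import Data.Nat using (ℕ; zero; suc; _<_; _≤_; z≤n; s≤s; _<?_)
open import Data.Nat.Induction using (<-wellFounded)
open import Data.Nat.Properties
  using (+-0-commutativeMonoid; +-mono-≤; +-mono-≤-<; ≤-refl) renaming (_≟_ to _≟ℕ_)
open import Data.Product using (_×_; _,_; proj₁; proj₂; Σ; ∃)
open import Data.Sum using (_⊎_; inj₁; inj₂)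
open import Data.Vec using (Vec; lookup; tabulate)
open import Data.Vec.Functional using (updateAt)
open import Data.Vec.Functional.Properties using (updateAt-updates; updateAt-minimal)
open import Data.Vec.Properties using (lookup∘update; lookup∘update′; lookup∘tabulate)
open import Function using (_∘_; const; id)
open import Function.Bundles using (_⇔_; mk⇔)
open import Induction.WellFounded using (Acc; acc)
open import Relation.Binary.PropositionalEquality
  using (_≡_; _≢_; _≗_; refl; sym; trans; cong; subst; subst₂)
open import Relation.Nullary using (¬_; Dec; yes; no; does; contradiction)
open import Relation.Nullary.Decidable
  using (T?; dec-true; dec-false; map′; _×-dec_; _→-dec_; ¬?)
open import Relation.Unary using (Decidable)
open import Algebra.Properties.CommutativeMonoid.Sum +-0-commutativeMonoid
  using (sum; sum-cong-≗; sum-permute)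

private variable
  n : ℕ

-- Transpositions

module _ (i j : Fin n) where

  transpose-left : transpose i j i ≡ j
  transpose-left rewrite dec-true (i ≟ i) refl = refl

  transpose-right : transpose i j j ≡ i
  transpose-right with j ≟ i
  ... | yes j≡i = j≡i
  ... | no  _ rewrite dec-true (j ≟ j) refl = refl

  transpose-fixes : ∀ {k} → k ≢ i → k ≢ j → transpose i j k ≡ k
  transpose-fixes {k} k≢i k≢j rewrite dec-false (k ≟ i) k≢i | dec-false (k ≟ j) k≢j = refl

  transpose-involutive : ∀ k → transpose i j (transpose i j k) ≡ k
  transpose-involutive k with k ≟ i
  ... | yes refl = transpose-right
  ... | no k≢i with k ≟ j
  ...   | yes refl = transpose-left
  ...   | no k≢j = transpose-fixes k≢i k≢j

  transpose-injective : ∀ {k l} → transpose i j k ≡ transpose i j l → k ≡ l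
  transpose-injective {k} {l} eq =
    trans (sym (transpose-involutive k)) (trans (cong (transpose i j) eq) (transpose-involutive l))

-- The degenerate case lets moves inside one class be treated by the same formulas as an exchange of
-- two classes.
transpose-refl : ∀ (i : Fin n) k → transpose i i k ≡ k
transpose-refl i k with k ≟ i
... | yes refl = refl
... | no  k≢i rewrite dec-false (k ≟ i) k≢i = refl

-- Conjugation and pointwise update of maps

Map : ℕ → Set
Map n = Fin n → Fin n

conj : Fin n → Fin n → Map n → Map n
conj i j M = transpose i j ∘ M ∘ transpose i j

conj-involutive : ∀ (i j : Fin n) M → conj i j (conj i j M) ≗ M
conj-involutive i j M k =
  trans (transpose-involutive i j (M _)) (cong M (transpose-involutive i j k))

assign : Map n → Fin n → Fin n → Map n
assign s i v = updateAt s i (const v)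

assign-same : ∀ (s : Map n) i v → assign s i v i ≡ v
assign-same s i v = updateAt-updates i s

assign-other : ∀ (s : Map n) i v {j} → j ≢ i → assign s i v j ≡ s j
assign-other s i v {j} = updateAt-minimal j i s

-- Counting labels and fixed points

indicator : Bool → ℕ
indicator b = if b then 1 else 0

count : (Fin n → Bool) → ℕ
count f = sum (indicator ∘ f)

indicator-mono : ∀ {a b} → (a ≡ true → b ≡ true) → indicator a ≤ indicator b
indicator-mono {false} imp = z≤n
indicator-mono {true} imp rewrite imp refl = ≤-refl

count-mono : ∀ {n} {f g : Fin n → Bool} → (∀ i → f i ≡ true → g i ≡ true) → count f ≤ count g
count-mono {zero} imp = z≤n
count-mono {suc n} imp = +-mono-≤ (indicator-mono (imp zero)) (count-mono (imp ∘ suc))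

count-strict : ∀ {n} {f g : Fin n → Bool} → (∀ i → f i ≡ true → g i ≡ true) →
  ∀ x → f x ≡ false → g x ≡ true → count f < count g
count-strict {f = f} {g} imp zero fx gx rewrite fx | gx = s≤s (count-mono (imp ∘ suc))
count-strict imp (suc x) fx gx =
  +-mono-≤-< (indicator-mono (imp zero)) (count-strict (imp ∘ suc) x fx gx)

fixes : Map n → Fin n → Bool
fixes M i = does (M i ≟ i)

-- A matching is an involution whose fixed points are the uncovered labels, so a maximum matching is
-- one with the fewest fixed points.
#fixed : Map n → ℕ
#fixed M = count (fixes M)

fixes-true : ∀ (M : Map n) {i} → fixes M i ≡ true → M i ≡ i
fixes-true M {i} eq with M i ≟ i
... | yes p = p

#fixed-ext : ∀ {M N : Map n} → M ≗ N → #fixed M ≡ #fixed N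
#fixed-ext {M = M} {N} eq = sum-cong-≗ λ i → cong (λ k → indicator (does (k ≟ i))) (eq i)

-- A label is fixed by the conjugate exactly when its transposed label is fixed by `M`, so the sum
-- is only permuted.
#fixed-conj : ∀ (i j : Fin n) M → #fixed (conj i j M) ≡ #fixed M
#fixed-conj i j M = trans (sum-cong-≗ pointwise)
  (sym (sum-permute (indicator ∘ fixes M) (transposition i j)))
  where
  pointwise : ∀ k → indicator (fixes (conj i j M) k) ≡ indicator (fixes M (transpose i j k))
  pointwise k with M (transpose i j k) ≟ transpose i j k
  ... | yes eq = cong indicator (dec-true (conj i j M k ≟ k)
          (trans (cong (transpose i j) eq) (transpose-involutive i j k)))
  ... | no neq = cong indicator (dec-false (conj i j M k ≟ k)
          λ eq → neq (trans (sym (transpose-involutive i j _)) (cong (transpose i j) eq)))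

-- Exhaustive search over maps

search-vec : ∀ {m n} {P : Vec (Fin m) n → Set} → Decidable P → Dec (∃ P)
search-vec {n = zero} P? = map′ (Vec.[] ,_) (λ { (Vec.[] , p) → p }) (P? Vec.[])
search-vec {n = suc n} P? =
  map′ (λ (x , xs , p) → x Vec.∷ xs , p) (λ { (x Vec.∷ xs , p) → x , xs , p })
    (any? λ x → search-vec λ xs → P? (x Vec.∷ xs))

-- The search runs over tables. A map agrees with its table only pointwise, hence the requirement
-- that `P` respect `≗`.
search : ∀ {P : Map n → Set} → (∀ {M N} → M ≗ N → P M → P N) → Decidable P → Dec (∃ P)
search resp P? =
  map′ (λ (xs , p) → lookup xs , p) (λ (M , p) → tabulate M , resp (sym ∘ lookup∘tabulate M) p)
    (search-vec (P? ∘ lookup))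

-- Unvisited vertices, edges and feasible moves

unvisited : Pos n → Fin n → Set
unvisited p v = lookup (visited p) v ≡ false

play-unvisited⁺ : ∀ (p : Pos n) {u v} → u ≢ v → unvisited p u → unvisited (play p v) u
play-unvisited⁺ p u≢v un = trans (lookup∘update′ u≢v (visited p) true) un

play-unvisited⁻ : ∀ (p : Pos n) {u v} → unvisited (play p v) u → u ≢ v × unvisited p u
play-unvisited⁻ p {u} {v} un with u ≟ v
... | yes refl with () ← trans (sym un) (lookup∘update v (visited p) true)
... | no u≢v = u≢v , trans (sym (lookup∘update′ u≢v (visited p) true)) un

Edge : Graph n → Fin n → Fin n → Set
Edge G u v = adj G u v ≡ true

Edge-sym : ∀ (G : Graph n) {u v} → Edge G u v → Edge G v u
Edge-sym G {u} {v} e = trans (Graph.sym G v u) e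

Edge-irrefl : ∀ (G : Graph n) {u v} → Edge G u v → u ≢ v
Edge-irrefl G {u} e refl with () ← trans (sym e) (irrefl G u)

feasible⁻ : ∀ (G : Graph n) p {v} → T (feasible G p v) → Edge G (current p) v × unvisited p v
feasible⁻ G p {v} f with adj G (current p) v | lookup (visited p) v
... | true | false = refl , refl

feasible⁺ : ∀ (G : Graph n) p {v} → Edge G (current p) v → unvisited p v → T (feasible G p v)
feasible⁺ G p e u rewrite e | u = _

-- States, matchings of classes and the invariant

-- Classes are named by labels in Fin n.  A label that is not alive names a class
-- with all its vertices visited.  Admissible plays the role of "of maximum size":
-- matchings are involutions of all labels, and after an exchange of moves their
-- restriction to the dead labels stays frozen instead of being removed.
record State (n : ℕ) : Set₁ where
  field
    label      : Fin n → Fin n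
    alive      : Fin n → Bool
    token      : Fin n
    Admissible : Map n → Set

  Alive : Fin n → Set
  Alive ℓ = alive ℓ ≡ true

  -- A section chooses the unvisited vertex of each living class; its values at dead labels are
  -- arbitrary.
  Section : Map n → Set
  Section s = ∀ {ℓ} → Alive ℓ → label (s ℓ) ≡ ℓ

  record Realizes (s : Map n) (p : Pos n) : Set where
    field
      at-token   : current p ≡ token
      unvisited⁻ : ∀ {v} → unvisited p v → Alive (label v) × s (label v) ≡ v
      unvisited⁺ : ∀ {ℓ} → Alive ℓ → unvisited p (s ℓ)

  -- Choices in different classes are independent, so a section can be redirected through any given
  -- vertex. This turns statements about all sections into statements about particular vertices.
  assign-section : ∀ {s v} → Section s → Section (assign s (label v) v)
  assign-section {s} {v} sec {ℓ} aℓ with ℓ ≟ label v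
  ... | yes refl = cong label (assign-same s (label v) v)
  ... | no  ℓ≢   = trans (cong label (assign-other s (label v) v ℓ≢)) (sec aℓ)

module _ {n : ℕ} (G : Graph n) where

  record Matches (alive : Fin n → Bool) (s M : Map n) : Set where
    field
      involutive : ∀ i → M (M i) ≡ i
      edge       : ∀ {i} → alive i ≡ true → M i ≢ i → alive (M i) ≡ true × Edge G (s i) (s (M i))

  open Matches public

  Matches-ext : ∀ {alive s M N} → M ≗ N → Matches alive s M → Matches alive s N
  Matches-ext {alive} {s} {M} {N} eq m = record
    { involutive = λ i → trans (sym (eq (N i))) (trans (cong M (sym (eq i))) (involutive m i))
    ; edge = λ {i} ai Ni≢i →
        subst (λ k → alive k ≡ true × Edge G (s i) (s k)) (eq i) (edge m ai (Ni≢i ∘ trans (sym (eq i))))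
    }

  Matches? : ∀ alive s M → Dec (Matches alive s M)
  Matches? alive s M = map′
    (λ (inv , e) → record { involutive = inv ; edge = λ {i} → e i })
    (λ m → involutive m , λ i → edge m)
    (all? (λ i → M (M i) ≟ i) ×-dec
     all? (λ i → (alive i ≟B true) →-dec (¬? (M i ≟ i) →-dec
       ((alive (M i) ≟B true) ×-dec (adj G (s i) (s (M i)) ≟B true)))))

  conj-involution : ∀ i j (M : Map n) → (∀ k → M (M k) ≡ k) → ∀ k → conj i j M (conj i j M k) ≡ k
  conj-involution i j M inv k =
    trans (cong (transpose i j ∘ M) (transpose-involutive i j _))
      (trans (cong (transpose i j) (inv _)) (transpose-involutive i j k))

  -- Exchanging partners of two edges, or moving an edge to an uncovered label, is
  -- conjugation by a transposition, so admissible-conj is the only closure property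
  -- of maximum matchings that is needed.
  record Invariant (st : State n) : Set where
    open State st
    field
      admissible?     : Decidable Admissible
      admissible-ext  : ∀ {M N} → M ≗ N → Admissible M → Admissible N
      admissible-conj : ∀ {M i j} → Alive i → Alive j → Admissible M → Admissible (conj i j M)
      section         : ∃ Section
      transfer        : ∀ {M s s′} → Admissible M →
                        Section s → Matches alive s M → Section s′ → Matches alive s′ M
      matching        : ∃ λ M → Admissible M × (∀ {s} → Section s → Matches alive s M)
      covers          : ∀ {x M s} → Edge G token x → Alive (label x) →
                        Admissible M → Section s → Matches alive s M → M (label x) ≢ label x

    -- The maximum matchings common to all realizations; by `transfer`, checking one section is
    -- enough.
    Uniform : Map n → Set
    Uniform M = Admissible M × (∀ {s} → Section s → Matches alive s M)

    uniform : ∀ {M s} → Admissible M → Section s → Matches alive s M → Uniform M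
    uniform a sec m = a , transfer a sec m

    Uniform-ext : ∀ {M N} → M ≗ N → Uniform M → Uniform N
    Uniform-ext eq (a , m) = admissible-ext eq a , λ sec → Matches-ext eq (m sec)

    -- Take a section through both `v` and `z`: there the matching edge at `label v` can only join
    -- `v` to `z`. Hence matched classes are completely joined.
    class-edge : ∀ {M v z} → Uniform M → Alive (label v) → M (label v) ≡ label z → label z ≢ label v → Edge G v z
    class-edge {M} {v} {z} (_ , m) av Mv≡z z≢v =
      subst₂ (Edge G) (trans (assign-other _ (label z) z (z≢v ∘ sym)) (assign-same s₀ (label v) v))
        (trans (cong s Mv≡z) (assign-same _ (label z) z))
        (proj₂ (edge (m (assign-section (assign-section (proj₂ section)))) av (z≢v ∘ trans (sym Mv≡z))))
      where
      s₀ s : Map n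
      s₀ = proj₁ section
      s = assign (assign s₀ (label v) v) (label z) z

  without : (Fin n → Bool) → Fin n → Fin n → Fin n → Bool
  without f c z ℓ = f ℓ ∧ not (does (ℓ ≟ c)) ∧ not (does (ℓ ≟ z))

  without⁻ : ∀ f {c z ℓ} → without f c z ℓ ≡ true → f ℓ ≡ true × ℓ ≢ c × ℓ ≢ z
  without⁻ f {c} {z} {ℓ} eq with f ℓ | ℓ ≟ c | ℓ ≟ z
  ... | true | no ℓ≢c | no ℓ≢z = refl , ℓ≢c , ℓ≢z

  without⁺ : ∀ f {c z ℓ} → f ℓ ≡ true → ℓ ≢ c → ℓ ≢ z → without f c z ℓ ≡ true
  without⁺ f {c} {z} {ℓ} fℓ ℓ≢c ℓ≢z
    rewrite fℓ | dec-false (ℓ ≟ c) ℓ≢c | dec-false (ℓ ≟ z) ℓ≢z = refl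

  without-count : ∀ {f c} z → f c ≡ true → count (without f c z) < count f
  without-count {f} {c} z fc = count-strict (λ ℓ → proj₁ ∘ without⁻ f) c
    (¬-not λ eq → proj₁ (proj₂ (without⁻ f {c} {z} eq)) refl) fc

  -- Quantum positions represented by states

  realization-feasible⁻ : ∀ {st s p v} → State.Realizes st s p → T (feasible G p v) →
    Edge G (State.token st) v × State.Alive st (State.label st v) × s (State.label st v) ≡ v
  realization-feasible⁻ {p = p} {v} r f with e , un ← feasible⁻ G p f =
    subst (λ t → Edge G t v) (State.Realizes.at-token r) e , State.Realizes.unvisited⁻ r un

  Represents : State n → QPos n → Set
  Represents st qs =
    (∀ {p} → p ∈ qs → ∃ λ s → Section s × Realizes s p) ×
    (∀ {s} → Section s → ∃ λ p → p ∈ qs × Realizes s p)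
    where open State st

  -- A classical move counts as a pair of equal vertices, so one argument serves both kinds of move.
  first second : QMove n → Fin n
  first (classical v) = v
  first (quantum v _ _) = v
  second (classical v) = v
  second (quantum _ v _) = v

  PlayedBy : QMove n → Fin n → Set
  PlayedBy m v = v ≡ first m ⊎ v ≡ second m

  ∈-step⁺ : ∀ {p v} → T (feasible G p v) → play p v ∈ step G v p
  ∈-step⁺ {p} {v} f with feasible G p v
  ... | true = here refl

  ∈-step⁻ : ∀ {p p′ v} → p′ ∈ step G v p → T (feasible G p v) × p′ ≡ play p v
  ∈-step⁻ {p} {p′} {v} p′∈ with feasible G p v
  ∈-step⁻ (here eq) | true = _ , eq

  ∈-qApply⁺ : ∀ m {qs p v} → p ∈ qs → PlayedBy m v → T (feasible G p v) → play p v ∈ qApply G qs m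
  ∈-qApply⁺ (classical v) p∈ (inj₁ refl) f = ∈-deduplicate⁺ _≟P_ (∈-map⁺ _ (∈-filter⁺ _ p∈ f))
  ∈-qApply⁺ (classical v) p∈ (inj₂ refl) f = ∈-deduplicate⁺ _≟P_ (∈-map⁺ _ (∈-filter⁺ _ p∈ f))
  ∈-qApply⁺ (quantum v₁ v₂ _) p∈ (inj₁ refl) f =
    ∈-deduplicate⁺ _≟P_ (∈-concatMap⁺ _ (lose p∈ (∈-++⁺ˡ (∈-step⁺ f))))
  ∈-qApply⁺ (quantum v₁ v₂ _) {p = p} p∈ (inj₂ refl) f =
    ∈-deduplicate⁺ _≟P_ (∈-concatMap⁺ _ (lose p∈ (∈-++⁺ʳ (step G v₁ p) (∈-step⁺ f))))

  ∈-qClassical⁻ : ∀ {qs p′ v} → p′ ∈ qClassical G qs v →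
    ∃ λ p → p ∈ qs × T (feasible G p v) × p′ ≡ play p v
  ∈-qClassical⁻ {v = v} p′∈
    with p , p∈ , eq ← ∈-map⁻ _ (∈-deduplicate⁻ _≟P_ _ p′∈)
    with p∈qs , f ← ∈-filter⁻ (λ b → T? (feasible G b v)) p∈ = p , p∈qs , f , eq

  ∈-qApply⁻ : ∀ m {qs p′} → p′ ∈ qApply G qs m →
    ∃ λ p → ∃ λ v → p ∈ qs × PlayedBy m v × T (feasible G p v) × p′ ≡ play p v
  ∈-qApply⁻ (classical v) p′∈ with p , p∈ , f , eq ← ∈-qClassical⁻ p′∈ = p , v , p∈ , inj₁ refl , f , eq
  ∈-qApply⁻ (quantum v₁ v₂ _) {qs} p′∈
    with p , p∈ , p′∈steps ←
      find (∈-concatMap⁻ (λ b → step G v₁ b ++ step G v₂ b) {xs = qs} (∈-deduplicate⁻ _≟P_ _ p′∈))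
    with ∈-++⁻ (step G v₁ p) p′∈steps
  ... | inj₁ ∈₁ with f , eq ← ∈-step⁻ ∈₁ = p , v₁ , p∈ , inj₁ refl , f , eq
  ... | inj₂ ∈₂ with f , eq ← ∈-step⁻ ∈₂ = p , v₂ , p∈ , inj₂ refl , f , eq

  legal⁻ : ∀ m {qs} → Legal G qs m → FeasibleSomewhere G qs (first m) × FeasibleSomewhere G qs (second m)
  legal⁻ (classical v) f = f , f
  legal⁻ (quantum _ _ _) fs = fs

  -- One exchange of moves and the next state

  record Reply (st : State n) (qs : QPos n) : Set₁ where
    field
      reply      : Fin n
      next       : State n
      invariant  : Invariant next
      decreasing : count (State.alive next) < count (State.alive st)
      represents : Represents next (qClassical G qs reply)

  module Strategy {st : State n} (inv : Invariant st) where

    open State st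
    open Invariant inv

    -- The opponent's move m is answered by z, which kills the class c and the class
    -- of z.
    module Advance (m : QMove n) (c z : Fin n) (label′ : Fin n → Fin n) (alive-c : Alive c)
      {M₀ : Map n} (uniform₀ : Uniform M₀) (M₀c≡Z : M₀ c ≡ label z) (M₀c≢c : M₀ c ≢ c) where

      Z : Fin n
      Z = label z

      st′ : State n
      st′ = record
        { label = label′ ; alive = without alive c Z ; token = z
        ; Admissible = λ M → Admissible M × M c ≡ Z }

      module ′ = State st′

      alive-Z : Alive Z
      alive-Z = subst Alive M₀c≡Z (proj₁ (edge (proj₂ uniform₀ (proj₂ section)) alive-c M₀c≢c))

      Z≢c : Z ≢ c
      Z≢c = M₀c≢c ∘ trans M₀c≡Z

      -- The conditions under which the realizations with v then z survive: reading
      -- the labels through the transposition (c label v) makes them realizations of st′.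
      record Link (v : Fin n) : Set where
        field
          token-edge   : Edge G token v
          alive-label  : Alive (label v)
          reply-edge   : Edge G v z
          label≢Z      : label v ≢ Z
          conj-uniform : ∀ {M} → Uniform M → Uniform (conj c (label v) M)
          relabel      : ∀ {u} → label u ≢ label v → label′ u ≡ transpose c (label v) (label u)

        E : Fin n
        E = label v

        π : Fin n → Fin n
        π = transpose c E

        πc : π c ≡ E
        πc = transpose-left c E

        πE : π E ≡ c
        πE = transpose-right c E

        πZ : π Z ≡ Z
        πZ = transpose-fixes c E Z≢c (label≢Z ∘ sym)

        ππ : ∀ ℓ → π (π ℓ) ≡ ℓ
        ππ = transpose-involutive c E

        π≢Z : ∀ {ℓ} → ℓ ≢ Z → π ℓ ≢ Z
        π≢Z ℓ≢Z eq = ℓ≢Z (trans (sym (ππ _)) (trans (cong π eq) πZ))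

        π≢c : ∀ {ℓ} → ℓ ≢ E → π ℓ ≢ c
        π≢c ℓ≢E eq = ℓ≢E (trans (sym (ππ _)) (trans (cong π eq) πc))

        π≢E : ∀ {ℓ} → ℓ ≢ c → π ℓ ≢ E
        π≢E ℓ≢c eq = ℓ≢c (trans (sym (ππ _)) (trans (cong π eq) πE))

        π-alive : ∀ {ℓ} → Alive ℓ → Alive (π ℓ)
        π-alive {ℓ} aℓ with ℓ ≟ c
        ... | yes refl = alive-label
        ... | no  ℓ≢c with ℓ ≟ E
        ...   | yes refl = alive-c
        ...   | no  ℓ≢E  = aℓ

      module Lifting {v} (link : Link v) {s′ : Map n}
        (labels : ∀ {ℓ} → ′.Alive ℓ → label (s′ ℓ) ≡ Link.π link ℓ) where

        open Link link

        -- The realization before the exchange: `s′` read through `π`, with the vertices `v` and `z`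
        -- put back as unvisited.
        lifted : Map n
        lifted = assign (assign (s′ ∘ π) Z z) E v

        lifted-E : lifted E ≡ v
        lifted-E = assign-same _ E v

        lifted-Z : lifted Z ≡ z
        lifted-Z = trans (assign-other _ E v (label≢Z ∘ sym)) (assign-same _ Z z)

        lifted-other : ∀ {ℓ} → ℓ ≢ E → ℓ ≢ Z → lifted ℓ ≡ s′ (π ℓ)
        lifted-other ℓ≢E ℓ≢Z = trans (assign-other _ E v ℓ≢E) (assign-other _ Z z ℓ≢Z)

        lifted-π : ∀ {ℓ} → ′.Alive ℓ → lifted (π ℓ) ≡ s′ ℓ
        lifted-π aℓ with _ , ℓ≢c , ℓ≢Z ← without⁻ alive aℓ =
          trans (lifted-other (π≢E ℓ≢c) (π≢Z ℓ≢Z)) (cong s′ (ππ _))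

        lifted-section : Section lifted
        lifted-section {ℓ} aℓ with ℓ ≟ E
        ... | yes refl = cong label lifted-E
        ... | no  ℓ≢E with ℓ ≟ Z
        ...   | yes refl = cong label lifted-Z
        ...   | no  ℓ≢Z  = trans (cong label (lifted-other ℓ≢E ℓ≢Z))
                             (trans (labels (without⁺ alive (π-alive aℓ) (π≢c ℓ≢E) (π≢Z ℓ≢Z))) (ππ ℓ))

        -- The conjugate pairs `E` with `Z`, which `lifted` turns into the edge from `v` to `z`;
        -- everywhere else it is `M` carried along `π`.
        lift-matches : ∀ {M} → M c ≡ Z → Matches ′.alive s′ M → Matches alive lifted (conj c E M)
        lift-matches {M} Mc≡Z m = record
          { involutive = conj-involution c E M (involutive m)
          -- Every label `j` is `π i` for `i = π j`, and there the conjugate has the value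
          -- `π (M i)`.
          ; edge = λ {j} aj Nj≢j → subst
              (λ k → π (M (π j)) ≢ k → Alive (π (M (π j))) × Edge G (lifted k) (lifted (π (M (π j)))))
              (ππ j) (at-π (π-alive aj)) Nj≢j }
          where
          MZ≡c : M Z ≡ c
          MZ≡c = trans (cong M (sym Mc≡Z)) (involutive m c)

          at-π : ∀ {i} → Alive i → π (M i) ≢ π i → Alive (π (M i)) × Edge G (lifted (π i)) (lifted (π (M i)))
          at-π {i} ai ≢ = cases (i ≟ c) (i ≟ Z)
            where
            cases : Dec (i ≡ c) → Dec (i ≡ Z) → Alive (π (M i)) × Edge G (lifted (π i)) (lifted (π (M i)))
            cases (yes refl) _ = subst Alive (sym πMc≡Z) alive-Z ,
              subst₂ (Edge G) (sym (trans (cong lifted πc) lifted-E)) (sym (trans (cong lifted πMc≡Z) lifted-Z))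
                reply-edge
              where
              πMc≡Z : π (M c) ≡ Z
              πMc≡Z = trans (cong π Mc≡Z) πZ
            cases (no _) (yes refl) = subst Alive (sym πMZ≡E) alive-label ,
              subst₂ (Edge G) (sym (trans (cong lifted πZ) lifted-Z)) (sym (trans (cong lifted πMZ≡E) lifted-E))
                (Edge-sym G reply-edge)
              where
              πMZ≡E : π (M Z) ≡ E
              πMZ≡E = trans (cong π MZ≡c) πc
            cases (no i≢c) (no i≢Z)
              with aMi , e ← edge m (without⁺ alive ai i≢c i≢Z) (≢ ∘ cong π) =
                π-alive (proj₁ (without⁻ alive aMi)) ,
                subst₂ (Edge G) (sym (lifted-π (without⁺ alive ai i≢c i≢Z))) (sym (lifted-π aMi)) e

        -- The restriction to the remaining labels is well defined: `c` and `Z` are partners of each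
        -- other, so no other label is matched to them.
        unlift-matches : ∀ {M} → (∀ i → M (M i) ≡ i) → M c ≡ Z →
                         Matches alive lifted (conj c E M) → Matches ′.alive s′ M
        unlift-matches {M} Minv Mc≡Z m = record { involutive = Minv ; edge = edge′ }
          where
          N : ∀ i → conj c E M (π i) ≡ π (M i)
          N i = cong (π ∘ M) (ππ i)

          edge′ : ∀ {i} → ′.Alive i → M i ≢ i → ′.Alive (M i) × Edge G (s′ i) (s′ (M i))
          edge′ {i} ai Mi≢i
            with aℓ , i≢c , i≢Z ← without⁻ alive ai
            with aN , e ← edge m (π-alive aℓ) (λ eq → Mi≢i (transpose-injective c E (trans (sym (N i)) eq))) =
              aMi , subst₂ (Edge G) (lifted-π ai) (trans (cong lifted (N i)) (lifted-π aMi)) e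
            where
            aMi : ′.Alive (M i)
            aMi = without⁺ alive
              (subst Alive (trans (cong π (N i)) (ππ _)) (π-alive aN))
              (λ eq → i≢Z (trans (sym (Minv i)) (trans (cong M eq) Mc≡Z)))
              (λ eq → i≢c (trans (sym (Minv i)) (trans (cong M (trans eq (sym Mc≡Z))) (Minv c))))

      link-section : ∀ {v} (link : Link v) {s} → Section s → ′.Section (s ∘ Link.π link)
      link-section link {s} sec {ℓ} aℓ with aℓ₀ , ℓ≢c , _ ← without⁻ alive aℓ =
          trans (relabel (π≢E ℓ≢c ∘ trans (sym sℓ))) (trans (cong π sℓ) (ππ ℓ))
        where
        open Link link
        sℓ : label (s (π ℓ)) ≡ π ℓ
        sℓ = sec (π-alive (proj₁ (without⁻ alive aℓ)))

      -- The unvisited vertices of the classes of `v` and `z` have just been played, so a vertex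
      -- still unvisited lies in another class, where `relabel` gives its new label.
      step-realizes : ∀ {v} (link : Link v) {s s′ p} → (∀ {ℓ} → ′.Alive ℓ → s′ ℓ ≡ s (Link.π link ℓ)) →
        Section s → Realizes s p → s (label v) ≡ v → s Z ≡ z → ′.Realizes s′ (play (play p v) z)
      step-realizes {v} link {s} {s′} {p} s′≡ sec r sE sZ = record
        { at-token = refl
        ; unvisited⁻ = back
        ; unvisited⁺ = λ {ℓ} aℓ → let aℓ₀ , ℓ≢c , ℓ≢Z = without⁻ alive aℓ in
            subst (unvisited (play (play p v) z)) (sym (s′≡ aℓ))
              (play-unvisited⁺ (play p v) (λ eq → π≢Z ℓ≢Z (trans (sym (sec (π-alive aℓ₀))) (cong label eq)))
                (play-unvisited⁺ p (λ eq → π≢E ℓ≢c (trans (sym (sec (π-alive aℓ₀))) (cong label eq)))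
                  (Realizes.unvisited⁺ r (π-alive aℓ₀))))
        }
        where
        open Link link
        back : ∀ {u} → unvisited (play (play p v) z) u → ′.Alive (label′ u) × s′ (label′ u) ≡ u
        back {u} un
          with u≢z , un₁ ← play-unvisited⁻ (play p v) un
          with u≢v , un₂ ← play-unvisited⁻ p un₁
          with au , su ← Realizes.unvisited⁻ r un₂ =
            subst (λ ℓ → ′.Alive ℓ × s′ ℓ ≡ u) (sym (relabel lu≢E))
              (aℓ , trans (s′≡ aℓ) (trans (cong s (ππ _)) su))
          where
          lu≢E : label u ≢ label v
          lu≢E eq = u≢v (trans (sym su) (trans (cong s eq) sE))
          lu≢Z : label u ≢ Z
          lu≢Z eq = u≢z (trans (sym su) (trans (cong s eq) sZ))
          aℓ : ′.Alive (π (label u))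
          aℓ = without⁺ alive (π-alive au) (π≢c lu≢E) (π≢Z lu≢Z)

      -- Records which vertex of `m` was taken on the way to the realization `s′`; after a merge
      -- this depends on `s′`.
      Lift : Map n → Set
      Lift s′ = ∃ λ v → Σ (Link v) λ link → PlayedBy m v × (∀ {ℓ} → ′.Alive ℓ → label (s′ ℓ) ≡ Link.π link ℓ)

      module WithLifts {v₀} (link₀ : Link v₀) (lift : ∀ {s′} → ′.Section s′ → Lift s′) where

        -- The lift of `M` matches one section of `st`, so it is uniform there; conjugating a second
        -- time gives back `M`.
        descend : ∀ {M s′} → ′.Admissible M → ′.Section s′ → Matches ′.alive s′ M → Uniform M
        descend {M} (adm , Mc≡Z) sec′ m with v , link , _ , labels ← lift sec′ =
            Uniform-ext (conj-involutive c (label v) M)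
              (conj-uniform (uniform (admissible-conj alive-c alive-label adm)
                lifted-section (lift-matches Mc≡Z m)))
          where
          open Link link
          open Lifting link labels

        -- Conjugate first, then restrict. Going down from one section and up to another yields
        -- `transfer` for the new state.
        ascend : ∀ {M s′} → M c ≡ Z → Uniform M → ′.Section s′ → Matches ′.alive s′ M
        ascend Mc≡Z u sec′ with v , link , _ , labels ← lift sec′ =
            unlift-matches (involutive (proj₂ u (proj₂ section))) Mc≡Z (proj₂ (conj-uniform u) lifted-section)
          where
          open Link link
          open Lifting link labels

        -- If M missed the class of a neighbour x of z, moving its edge at z from the
        -- class just played to the class of x would leave that class, reachable from
        -- the old token, uncovered.
        covers′ : ∀ {x M s} → Edge G z x → ′.Alive (label′ x) →
                  ′.Admissible M → ′.Section s → Matches ′.alive s M → M (label′ x) ≢ label′ x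
        covers′ {x} {M} {s} zx alive-U (adm , Mc≡Z) sec′ m MU≡U
          -- The edge from `z` to `x` is usable only in a section through `x`, and `s` may choose
          -- another vertex of that class.
          with v , link , _ , labels ← lift (′.assign-section {v = x} sec′)
          with aU , _ , U≢Z ← without⁻ alive alive-U =
            covers token-edge alive-label (admissible-conj alive-label (π-alive aU) (proj₁ uniform-N))
              lifted-section valid-N′ N′E≡E
          where
          open Link link
          open Lifting link labels
          U P : Fin n
          U = label′ x
          P = π U
          N N′ ρ : Map n
          N = conj c E M
          -- `N` pairs `E` with `Z` and fixes `P`; the conjugate pairs `P` with `Z` and leaves `E`
          -- uncovered.
          N′ = conj E P N
          ρ = transpose E P
          uniform-N : Uniform N
          uniform-N = conj-uniform (descend (adm , Mc≡Z) sec′ m)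
          valid-N : Matches alive lifted N
          valid-N = proj₂ uniform-N lifted-section
          P≢Z : P ≢ Z
          P≢Z = π≢Z U≢Z
          lifted-P : lifted P ≡ x
          lifted-P = trans (lifted-π alive-U) (assign-same s U x)
          NE≡Z : N E ≡ Z
          NE≡Z = trans (cong (π ∘ M) πE) (trans (cong π Mc≡Z) πZ)
          NZ≡E : N Z ≡ E
          NZ≡E = trans (cong N (sym NE≡Z)) (involutive valid-N E)
          NP≡P : N P ≡ P
          NP≡P = trans (cong (π ∘ M) (ππ U)) (cong π MU≡U)
          N′E≡E : N′ E ≡ E
          N′E≡E = trans (cong (ρ ∘ N) (transpose-left E P)) (trans (cong ρ NP≡P) (transpose-right E P))
          N′P≡Z : N′ P ≡ Z
          N′P≡Z = trans (cong (ρ ∘ N) (transpose-right E P))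
            (trans (cong ρ NE≡Z) (transpose-fixes E P (label≢Z ∘ sym) (P≢Z ∘ sym)))
          N′Z≡P : N′ Z ≡ P
          N′Z≡P = trans (cong (ρ ∘ N) (transpose-fixes E P (label≢Z ∘ sym) (P≢Z ∘ sym)))
            (trans (cong ρ NZ≡E) (transpose-left E P))
          N′-other : ∀ {j} → j ≢ E → j ≢ P → j ≢ Z → N′ j ≡ N j
          N′-other {j} j≢E j≢P j≢Z = trans (cong (ρ ∘ N) (transpose-fixes E P j≢E j≢P))
            (transpose-fixes E P
              (λ eq → j≢Z (trans (sym (involutive valid-N j)) (trans (cong N eq) NE≡Z)))
              (λ eq → j≢P (trans (sym (involutive valid-N j)) (trans (cong N eq) NP≡P))))
          edge-N′ : ∀ {j} → Alive j → N′ j ≢ j → Alive (N′ j) × Edge G (lifted j) (lifted (N′ j))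
          edge-N′ {j} aj ≢ = cases (j ≟ E) (j ≟ P) (j ≟ Z)
            where
            cases : Dec (j ≡ E) → Dec (j ≡ P) → Dec (j ≡ Z) → Alive (N′ j) × Edge G (lifted j) (lifted (N′ j))
            cases (yes refl) _ _ = contradiction N′E≡E ≢
            cases (no _) (yes refl) _ = subst (λ k → Alive k × Edge G (lifted P) (lifted k)) (sym N′P≡Z)
              (alive-Z , subst₂ (Edge G) (sym lifted-P) (sym lifted-Z) (Edge-sym G zx))
            cases (no _) (no _) (yes refl) = subst (λ k → Alive k × Edge G (lifted Z) (lifted k)) (sym N′Z≡P)
              (π-alive aU , subst₂ (Edge G) (sym lifted-Z) (sym lifted-P) zx)
            cases (no j≢E) (no j≢P) (no j≢Z) =
              subst (λ k → Alive k × Edge G (lifted j) (lifted k)) (sym N′j≡Nj)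
                (edge valid-N aj (≢ ∘ trans N′j≡Nj))
              where
              N′j≡Nj : N′ j ≡ N j
              N′j≡Nj = N′-other j≢E j≢P j≢Z
          valid-N′ : Matches alive lifted N′
          valid-N′ = record { involutive = conj-involution E P N (involutive valid-N) ; edge = edge-N′ }

        advanced : Invariant st′
        advanced = record
          { admissible? = λ M → admissible? M ×-dec (M c ≟ Z)
          ; admissible-ext = λ eq (adm , Mc≡Z) → admissible-ext eq adm , trans (sym (eq c)) Mc≡Z
          ; admissible-conj = λ {M} {i} {j} ai aj (adm , Mc≡Z) →
              let ai₀ , i≢c , i≢Z = without⁻ alive ai
                  aj₀ , j≢c , j≢Z = without⁻ alive aj
              in admissible-conj ai₀ aj₀ adm ,
                 trans (cong (transpose i j ∘ M) (transpose-fixes i j (i≢c ∘ sym) (j≢c ∘ sym)))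
                   (trans (cong (transpose i j) Mc≡Z) (transpose-fixes i j (i≢Z ∘ sym) (j≢Z ∘ sym)))
          ; section = _ , λ {ℓ} → link-section link₀ (proj₂ section) {ℓ}
          ; transfer = λ adm sec m sec′ → ascend (proj₂ adm) (descend adm sec m) sec′
          ; matching = M₀ , (proj₁ uniform₀ , M₀c≡Z) , ascend M₀c≡Z uniform₀
          ; covers = covers′
          }

        -- Realizations whose token is not adjacent to `z` collapse under the answer, so a link is
        -- demanded only for vertices of `m` adjacent to `z`.
        advance-reply : ∀ {qs} → Represents st qs →
          (∀ {v} → PlayedBy m v → Edge G token v → Alive (label v) → Edge G v z → Link v) →
          Reply st (qApply G qs m)
        advance-reply {qs} rep survive = record
          { reply = z ; next = st′ ; invariant = advanced
          ; decreasing = without-count Z alive-c ; represents = sound , complete }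
          where
          sound : ∀ {p″} → p″ ∈ qClassical G (qApply G qs m) z → ∃ λ s′ → ′.Section s′ × ′.Realizes s′ p″
          sound p″∈
            with p′ , p′∈ , f′ , refl ← ∈-qClassical⁻ p″∈
            with p , v , p∈ , played , f , refl ← ∈-qApply⁻ m p′∈
            with s , sec , r ← proj₁ rep p∈
            with tv , av , sv ← realization-feasible⁻ r f
            with vz , un ← feasible⁻ G (play p v) f′ =
              _ , (λ {ℓ} → link-section link sec {ℓ}) ,
              step-realizes link (λ _ → refl) sec r sv
                (proj₂ (Realizes.unvisited⁻ r (proj₂ (play-unvisited⁻ p un))))
            where
            link : Link v
            link = survive played tv av vz
          complete : ∀ {s′} → ′.Section s′ → ∃ λ p″ → p″ ∈ qClassical G (qApply G qs m) z × ′.Realizes s′ p″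
          complete {s′} sec′
            with v , link , played , labels ← lift sec′
            with p , p∈ , r ← proj₂ rep (Lifting.lifted-section link labels) =
              play (play p v) z ,
              ∈-qApply⁺ (classical z) (∈-qApply⁺ m p∈ played feasible-v) (inj₁ refl) feasible-z ,
              step-realizes link (sym ∘ lifted-π) lifted-section r lifted-E lifted-Z
            where
            open Link link
            open Lifting link labels
            feasible-v : T (feasible G p v)
            feasible-v = feasible⁺ G p (subst (λ t → Edge G t v) (sym (Realizes.at-token r)) token-edge)
              (subst (unvisited p) lifted-E (Realizes.unvisited⁺ r alive-label))
            feasible-z : T (feasible G (play p v) z)
            feasible-z = feasible⁺ G (play p v) reply-edge
              (play-unvisited⁺ p (Edge-irrefl G reply-edge ∘ sym)
                (subst (unvisited p) lifted-Z (Realizes.unvisited⁺ r alive-Z)))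

    -- Answers after which only one class has been entered

    module Collapse (m : QMove n) {x z : Fin n}
      (token-x : Edge G token x) (alive-x : Alive (label x)) (played-x : PlayedBy m x)
      {M : Map n} (uniform-M : Uniform M) (Mx≡z : M (label x) ≡ label z) where

      private
        Mx≢x : M (label x) ≢ label x
        Mx≢x = covers token-x alive-x (proj₁ uniform-M) (proj₂ section) (proj₂ uniform-M (proj₂ section))

      open Advance m (label x) z label alive-x uniform-M Mx≡z Mx≢x public

      -- Here the transposition is the identity, so conjugation and relabelling change nothing, and
      -- `class-edge` joins each vertex of the class to `z`.
      same-class-link : ∀ {v} → Edge G token v → label v ≡ label x → Link v
      same-class-link {v} tv lv≡lx = record
        { token-edge = tv
        ; alive-label = alive-v
        ; reply-edge = class-edge uniform-M alive-v (trans (cong M lv≡lx) Mx≡z) (λ eq → Z≢c (trans eq lv≡lx))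
        ; label≢Z = λ eq → Z≢c (trans (sym eq) lv≡lx)
        ; conj-uniform = λ {N} → Uniform-ext (λ k →
            sym (trans (identity (N _)) (cong N (identity k))))
        ; relabel = λ {u} _ → sym (identity (label u))
        }
        where
        alive-v : Alive (label v)
        alive-v = subst Alive (sym lv≡lx) alive-x
        identity : ∀ k → transpose (label x) (label v) k ≡ k
        identity k = trans (cong (λ ℓ → transpose (label x) ℓ k) lv≡lx) (transpose-refl (label x) k)

      lift : ∀ {s′} → ′.Section s′ → Lift s′
      lift sec′ = x , same-class-link token-x refl , played-x ,
        λ {ℓ} aℓ → trans (sec′ aℓ) (sym (transpose-refl (label x) ℓ))

      open WithLifts (same-class-link token-x refl) lift public

    -- Answers that merge two classes

    module Merge (m : QMove n) {x y : Fin n}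
      (token-x : Edge G token x) (alive-x : Alive (label x)) (played-x : PlayedBy m x)
      (token-y : Edge G token y) (alive-y : Alive (label y)) (played-y : PlayedBy m y)
      (lx≢ly : label x ≢ label y)
      (reaches-y : ∀ {M u} → Uniform M → M (label x) ≡ label u → Edge G y u)
      (reaches-x : ∀ {M u} → Uniform M → M (label y) ≡ label u → Edge G x u)
      {M₀ : Map n} (uniform₀ : Uniform M₀) {z : Fin n} (M₀x≡z : M₀ (label x) ≡ label z) where

      private
        C D : Fin n
        C = label x
        D = label y

        M₀x≢x : M₀ C ≢ C
        M₀x≢x = covers token-x alive-x (proj₁ uniform₀) (proj₂ section) (proj₂ uniform₀ (proj₂ section))

        -- The merged class is called `D` because `C` is the label that dies. Its one unvisited
        -- vertex is the old choice in `D` if `x` was played, and that in `C` if `y` was.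
        merged : Fin n → Fin n
        merged u = if does (label u ≟ C) then D else label u

        merged-C : ∀ {u} → label u ≡ C → merged u ≡ D
        merged-C {u} eq rewrite dec-true (label u ≟ C) eq = refl

        merged-other : ∀ {u} → label u ≢ C → merged u ≡ label u
        merged-other {u} neq rewrite dec-false (label u ≟ C) neq = refl

      open Advance m C z merged alive-x uniform₀ M₀x≡z M₀x≢x public

      -- Otherwise `y` would itself be a vertex that `y` must reach, which would be a loop.
      not-matched : ∀ {M} → Uniform M → M C ≢ D
      not-matched u eq = Edge-irrefl G (reaches-y u eq) refl

      -- One section suffices. In the one through `x` and `y`, the edges needed after trading
      -- partners are those given by `reaches-x` and `reaches-y`.
      swap-uniform : ∀ {M} → Uniform M → Uniform (conj C D M)
      swap-uniform {M} u = uniform (admissible-conj alive-x alive-y (proj₁ u)) sec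
          (record { involutive = conj-involution C D M inv-M ; edge = edge-N })
        where
        s : Map n
        s = assign (assign (proj₁ section) C x) D y
        sec : Section s
        sec = assign-section (assign-section (proj₂ section))
        sC : s C ≡ x
        sC = trans (assign-other _ D y lx≢ly) (assign-same _ C x)
        sD : s D ≡ y
        sD = assign-same _ D y
        ms : Matches alive s M
        ms = proj₂ u sec
        inv-M : ∀ i → M (M i) ≡ i
        inv-M = involutive ms
        π N : Map n
        π = transpose C D
        N = conj C D M
        M-alive : ∀ {i} → Alive i → Alive (M i)
        M-alive {i} ai with M i ≟ i
        ... | yes eq = subst Alive (sym eq) ai
        ... | no neq = proj₁ (edge ms ai neq)
        MC≢D : M C ≢ D
        MC≢D = not-matched u
        MD≢C : M D ≢ C
        MD≢C eq = MC≢D (trans (cong M (sym eq)) (inv-M D))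
        edge-N : ∀ {i} → Alive i → N i ≢ i → Alive (N i) × Edge G (s i) (s (N i))
        edge-N {i} ai Ni≢i = cases (i ≟ C) (i ≟ D) (M i ≟ C) (M i ≟ D)
          where
          Ni : ∀ {k ℓ} → π i ≡ k → π (M k) ≡ ℓ → N i ≡ ℓ
          Ni eq₁ eq₂ = trans (cong (π ∘ M) eq₁) eq₂
          result : ∀ {ℓ} → N i ≡ ℓ → Alive ℓ → Edge G (s i) (s ℓ) → Alive (N i) × Edge G (s i) (s (N i))
          result eq aℓ e = subst (λ k → Alive k × Edge G (s i) (s k)) (sym eq) (aℓ , e)
          cases : Dec (i ≡ C) → Dec (i ≡ D) → Dec (M i ≡ C) → Dec (M i ≡ D) →
            Alive (N i) × Edge G (s i) (s (N i))
          cases (yes refl) _ _ _ =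
              result (Ni (transpose-left C D) (transpose-fixes C D MD≢C MD≢D)) (M-alive alive-y)
              (subst (λ v → Edge G v (s (M D))) (sym sC) (reaches-x u (sym (sec (M-alive alive-y)))))
            where
            MD≢D : M D ≢ D
            MD≢D eq = Ni≢i (Ni (transpose-left C D) (trans (cong π eq) (transpose-right C D)))
          cases (no _) (yes refl) _ _ =
              result (Ni (transpose-right C D) (transpose-fixes C D MC≢C MC≢D)) (M-alive alive-x)
              (subst (λ v → Edge G v (s (M C))) (sym sD) (reaches-y u (sym (sec (M-alive alive-x)))))
            where
            MC≢C : M C ≢ C
            MC≢C eq = Ni≢i (Ni (transpose-right C D) (trans (cong π eq) (transpose-left C D)))
          cases (no i≢C) (no i≢D) (yes Mi≡C) _ =
            result (Ni (transpose-fixes C D i≢C i≢D) (trans (cong π Mi≡C) (transpose-left C D))) alive-y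
              (subst (Edge G (s i)) (sym sD)
                (Edge-sym G (reaches-y u (trans (cong M (sym Mi≡C)) (trans (inv-M i) (sym (sec ai)))))))
          cases (no i≢C) (no i≢D) (no _) (yes Mi≡D) =
            result (Ni (transpose-fixes C D i≢C i≢D) (trans (cong π Mi≡D) (transpose-right C D))) alive-x
              (subst (Edge G (s i)) (sym sC)
                (Edge-sym G (reaches-x u (trans (cong M (sym Mi≡D)) (trans (inv-M i) (sym (sec ai)))))))
          cases (no i≢C) (no i≢D) (no Mi≢C) (no Mi≢D) =
              result Ni≡Mi (M-alive ai) (proj₂ (edge ms ai (Ni≢i ∘ trans Ni≡Mi)))
            where
            Ni≡Mi : N i ≡ M i
            Ni≡Mi = Ni (transpose-fixes C D i≢C i≢D) (transpose-fixes C D Mi≢C Mi≢D)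

      link-x : Link x
      link-x = record
        { token-edge = token-x
        ; alive-label = alive-x
        ; reply-edge = class-edge uniform₀ alive-x M₀x≡z Z≢c
        ; label≢Z = Z≢c ∘ sym
        ; conj-uniform = λ {N} → Uniform-ext λ k →
            sym (trans (transpose-refl C (N _)) (cong N (transpose-refl C k)))
        ; relabel = λ {u} lu≢ → trans (merged-other lu≢) (sym (transpose-refl C (label u)))
        }

      link-y : Link y
      link-y = record
        { token-edge = token-y
        ; alive-label = alive-y
        ; reply-edge = reaches-y uniform₀ M₀x≡z
        ; label≢Z = not-matched uniform₀ ∘ trans M₀x≡z ∘ sym
        ; conj-uniform = swap-uniform
        ; relabel = relabel-y
        }
        where
        relabel-y : ∀ {u} → label u ≢ D → merged u ≡ transpose C D (label u)
        relabel-y {u} lu≢D = cases (label u ≟ C)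
          where
          cases : Dec (label u ≡ C) → merged u ≡ transpose C D (label u)
          cases (yes eq) = trans (merged-C eq) (sym (trans (cong (transpose C D) eq) (transpose-left C D)))
          cases (no neq) = trans (merged-other neq) (sym (transpose-fixes C D neq lu≢D))

      -- The choice in the merged class reveals the move: a vertex of the old class `C` is still
      -- unvisited only if `y` was played, one of `D` only if `x` was.
      lift : ∀ {s′} → ′.Section s′ → Lift s′
      lift {s′} sec′ with label (s′ D) ≟ C
      ... | yes eq = y , link-y , played-y , labels
        where
        labels : ∀ {ℓ} → ′.Alive ℓ → label (s′ ℓ) ≡ transpose C D ℓ
        labels {ℓ} aℓ = cases (ℓ ≟ D) (label (s′ ℓ) ≟ C)
          where
          cases : Dec (ℓ ≡ D) → Dec (label (s′ ℓ) ≡ C) → label (s′ ℓ) ≡ transpose C D ℓ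
          cases (yes refl) _ = trans eq (sym (transpose-right C D))
          cases (no ℓ≢D) (yes l≡C) = contradiction (trans (sym (sec′ aℓ)) (merged-C l≡C)) ℓ≢D
          cases (no ℓ≢D) (no l≢C) = trans (trans (sym (merged-other l≢C)) (sec′ aℓ))
            (sym (transpose-fixes C D (proj₁ (proj₂ (without⁻ alive aℓ))) ℓ≢D))
      ... | no neq = x , link-x , played-x , labels
        where
        labels : ∀ {ℓ} → ′.Alive ℓ → label (s′ ℓ) ≡ transpose C C ℓ
        labels {ℓ} aℓ = trans (cases (label (s′ ℓ) ≟ C)) (sym (transpose-refl C ℓ))
          where
          cases : Dec (label (s′ ℓ) ≡ C) → label (s′ ℓ) ≡ ℓ
          cases (yes l≡C) = contradiction
            (subst (λ k → label (s′ k) ≡ C) (trans (sym (sec′ aℓ)) (merged-C l≡C)) l≡C) neq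
          cases (no l≢C) = trans (sym (merged-other l≢C)) (sec′ aℓ)

      open WithLifts link-x lift public

    -- Choosing the answer

    module _ {qs : QPos n} (rep : Represents st qs) (m : QMove n) where

      collapse-reply : ∀ {x z M} → Edge G token x → Alive (label x) → PlayedBy m x →
        Uniform M → M (label x) ≡ label z →
        (∀ {v} → PlayedBy m v → Edge G v z → label v ≡ label x) → Reply st (qApply G qs m)
      collapse-reply tx ax px u Mx≡z survivors =
        advance-reply rep λ played tv _ vz → same-class-link tv (survivors played vz)
        where open Collapse m tx ax px u Mx≡z

      -- Formulated for one fixed section so that it can be decided by search; `uniform` extends a
      -- witness to all sections.
      Blocked : Fin n → Fin n → Map n → Set
      Blocked x y M = Admissible M × Matches alive (proj₁ section) M ×
        ∃ λ z → M (label x) ≡ label z × adj G y z ≡ false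

      blocked? : ∀ x y → Dec (∃ (Blocked x y))
      blocked? x y = search
        (λ eq (adm , ms , z , Mx≡z , yz) →
          admissible-ext eq adm , Matches-ext eq ms , z , trans (sym (eq (label x))) Mx≡z , yz)
        (λ M → admissible? M ×-dec Matches? alive (proj₁ section) M ×-dec
          any? λ z → (M (label x) ≟ label z) ×-dec (adj G y z ≟B false))

      unblocked : ∀ {x y} → ¬ ∃ (Blocked x y) → ∀ {M u} → Uniform M → M (label x) ≡ label u → Edge G y u
      unblocked {x} {y} ¬b {M} {u} (adm , ms) Mx≡u =
        ¬-not λ yu → ¬b (M , adm , ms (proj₂ section) , u , Mx≡u , yu)

      reply-to : Legal G qs m → Reply st (qApply G qs m)
      reply-to legal = choose (label x ≟ label y) (blocked? x y) (blocked? y x)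
        where
        x y : Fin n
        x = first m
        y = second m
        available : ∀ {v} → FeasibleSomewhere G qs v → Edge G token v × Alive (label v)
        available somewhere with p , p∈ , f ← find somewhere with s , _ , r ← proj₁ rep p∈
          with tv , av , _ ← realization-feasible⁻ r f = tv , av
        available-x : Edge G token x × Alive (label x)
        available-x = available (proj₁ (legal⁻ m legal))
        available-y : Edge G token y × Alive (label y)
        available-y = available (proj₂ (legal⁻ m legal))
        M₀ s₀ : Map n
        M₀ = proj₁ matching
        s₀ = proj₁ section
        z : Fin n
        z = s₀ (M₀ (label x))
        matched₀ : Matches alive s₀ M₀
        matched₀ = proj₂ (proj₂ matching) (proj₂ section)
        M₀x≡z : M₀ (label x) ≡ label z
        M₀x≡z = sym (proj₂ section (proj₁ (edge matched₀ (proj₂ available-x)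
          (covers (proj₁ available-x) (proj₂ available-x) (proj₁ (proj₂ matching)) (proj₂ section) matched₀))))

        choose : Dec (label x ≡ label y) → Dec (∃ (Blocked x y)) → Dec (∃ (Blocked y x)) → Reply st (qApply G qs m)
        -- This case contains all classical moves; every vertex of the class has the same partner
        -- class, so no realization collapses.
        choose (yes lx≡ly) _ _ =
          collapse-reply (proj₁ available-x) (proj₂ available-x) (inj₁ refl) (proj₂ matching) M₀x≡z
            λ { (inj₁ refl) _ → refl ; (inj₂ refl) _ → sym lx≡ly }
        choose (no _) (yes (M , adm , ms , z , Mx≡z , yz)) _ =
          collapse-reply (proj₁ available-x) (proj₂ available-x) (inj₁ refl) (uniform adm (proj₂ section) ms) Mx≡z
            λ { (inj₁ refl) _ → refl ; (inj₂ refl) e → contradiction (trans (sym e) yz) λ () }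
        choose (no _) (no _) (yes (M , adm , ms , z , My≡z , xz)) =
          collapse-reply (proj₁ available-y) (proj₂ available-y) (inj₂ refl) (uniform adm (proj₂ section) ms) My≡z
            λ { (inj₁ refl) e → contradiction (trans (sym e) xz) λ () ; (inj₂ refl) _ → refl }
        choose (no lx≢ly) (no ¬bx) (no ¬by) =
          advance-reply rep λ { (inj₁ refl) _ _ _ → link-x ; (inj₂ refl) _ _ _ → link-y }
          where
          open Merge m
            (proj₁ available-x) (proj₂ available-x) (inj₁ refl) (proj₁ available-y) (proj₂ available-y) (inj₂ refl)
            lx≢ly (unblocked ¬bx) (unblocked ¬by) (proj₂ matching) M₀x≡z

  -- From the invariant to the outcomes

  -- A single realization is followed through the same states: `v` is answered by the vertex that
  -- this realization has in the class matched to that of `v`.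
  invariant⇒ClP : ∀ {st s p} → Acc _<_ (count (State.alive st)) → Invariant st →
    State.Section st s → State.Realizes st s p → ClP G p
  invariant⇒ClP {st} {s} {p} (acc rec) inv sec r = clP respond
    where
    open State st
    open Invariant inv
    M : Map n
    M = proj₁ matching
    respond : ∀ v → T (feasible G p v) → ClN G (play p v)
    respond v f with e , av , sv ← realization-feasible⁻ r f =
        clN z (feasible⁺ G (play p v) (Link.reply-edge link)
            (play-unvisited⁺ p z≢v (Realizes.unvisited⁺ r alive-Mv)))
          (invariant⇒ClP (rec (without-count Z av)) advanced (λ {ℓ} → link-section link sec {ℓ})
            (step-realizes link (λ _ → refl) sec r sv (cong s lz)))
      where
      alive-Mv : Alive (M (label v))
      alive-Mv = proj₁ (edge (proj₂ (proj₂ matching) sec) av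
        (covers e av (proj₁ (proj₂ matching)) sec (proj₂ (proj₂ matching) sec)))
      z : Fin n
      z = s (M (label v))
      lz : label z ≡ M (label v)
      lz = sec alive-Mv
      open Strategy.Collapse inv (classical v) {z = z} e av (inj₁ refl) (proj₂ matching) (sym lz)
      link : Link v
      link = same-class-link e refl
      z≢v : z ≢ v
      z≢v eq = Z≢c (cong label eq)

  invariant⇒QP : ∀ {st qs} → Acc _<_ (count (State.alive st)) → Invariant st → Represents st qs → QP G qs
  invariant⇒QP {st} {qs} (acc rec) inv rep = qP λ m legal → answer m (Strategy.reply-to inv rep m legal)
    where
    answer : ∀ m → Reply st (qApply G qs m) → QN G (qApply G qs m)
    answer m R = qN (classical reply) legal-reply (invariant⇒QP (rec decreasing) invariant represents)
      where
      open Reply R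
      -- The next state has a section, so some realization survives the answer.
      legal-reply : FeasibleSomewhere G (qApply G qs m) reply
      legal-reply with _ , p″∈ , _ ← proj₂ represents (proj₂ (Invariant.section invariant))
        with p′ , p′∈ , f , _ ← ∈-qClassical⁻ p″∈ = lose p′∈ f

  -- Maximum matchings and initial states

  free : Pos n → Fin n → Bool
  free p v = not (lookup (visited p) v)

  free⁻ : ∀ p {v} → free p v ≡ true → unvisited p v
  free⁻ p {v} eq with lookup (visited p) v
  ... | false = refl

  free⁺ : ∀ p {v} → unvisited p v → free p v ≡ true
  free⁺ p un = cong not un

  -- `Matches` asks for no edges between visited vertices; pairing these freely would lower `#fixed`
  -- and spoil it as a measure of size.
  FixesVisited : Pos n → Map n → Set
  FixesVisited p M = ∀ i → lookup (visited p) i ≡ true → M i ≡ i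

  IsMatching : Pos n → Map n → Set
  IsMatching p M = Matches (free p) id M × FixesVisited p M

  FixesVisited-ext : ∀ {p M N} → M ≗ N → FixesVisited p M → FixesVisited p N
  FixesVisited-ext eq fix i vi = trans (sym (eq i)) (fix i vi)

  FixesVisited? : ∀ p → Decidable (FixesVisited p)
  FixesVisited? p M = all? λ i → (lookup (visited p) i ≟B true) →-dec (M i ≟ i)

  IsMatching-ext : ∀ {p M N} → M ≗ N → IsMatching p M → IsMatching p N
  IsMatching-ext {p} eq (ms , fix) = Matches-ext eq ms , FixesVisited-ext {p} eq fix

  IsMatching? : ∀ p → Decidable (IsMatching p)
  IsMatching? p M = Matches? (free p) id M ×-dec FixesVisited? p M

  -- Start from the empty matching and improve it as long as the search finds one with fewer fixed
  -- points.
  maximum-matching : ∀ p → ∃ λ M → IsMatching p M × (∀ {N} → IsMatching p N → ¬ #fixed N < #fixed M)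
  maximum-matching p = improve id identity-matching (<-wellFounded _)
    where
    identity-matching : IsMatching p id
    identity-matching =
      record { involutive = λ _ → refl ; edge = λ _ i≢i → contradiction refl i≢i } , λ _ _ → refl
    improve : ∀ M → IsMatching p M → Acc _<_ (#fixed M) →
      ∃ λ M → IsMatching p M × (∀ {N} → IsMatching p N → ¬ #fixed N < #fixed M)
    improve M ms (acc rec)
      with search (λ {N} eq (ns , lt) → IsMatching-ext {p} eq ns , subst (_< #fixed M) (#fixed-ext eq) lt)
             (λ N → IsMatching? p N ×-dec (#fixed N <? #fixed M))
    ... | yes (N , ns , lt) = improve N ns (rec lt)
    ... | no  ¬better = M , ms , λ ns lt → ¬better (_ , ns , lt)

  -- Every class is a single vertex, so all sections agree on living labels and `transfer` is
  -- immediate.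
  initial : Pos n → ℕ → State n
  initial p k = record
    { label = id ; alive = free p ; token = current p ; Admissible = λ M → #fixed M ≡ k × FixesVisited p M }

  initial-invariant : ∀ p {k M} → IsMatching p M → #fixed M ≡ k →
    (∀ {x N} → Edge G (current p) x → unvisited p x → IsMatching p N → #fixed N ≡ k → N x ≢ x) →
    Invariant (initial p k)
  initial-invariant p {k} {M} (ms , fix) #M cov = record
    { admissible? = λ N → (#fixed N ≟ℕ k) ×-dec FixesVisited? p N
    ; admissible-ext = λ eq (#N , fixN) → trans (sym (#fixed-ext eq)) #N , FixesVisited-ext {p} eq fixN
    ; admissible-conj = λ {N} {i} {j} ai aj (#N , fixN) → trans (#fixed-conj i j N) #N ,
        λ v vv → let τv = transpose-fixes i j (visited≢free ai vv) (visited≢free aj vv) in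
          trans (cong (transpose i j ∘ N) τv) (trans (cong (transpose i j) (fixN v vv)) τv)
    ; section = id , λ _ → refl
    ; transfer = λ adm sec ns sec′ → change sec sec′ ns
    ; matching = M , (#M , fix) , λ sec → change (λ _ → refl) sec ms
    ; covers = λ e ax (#N , fixN) sec ns → cov e (free⁻ p ax) (change sec (λ _ → refl) ns , fixN) #N
    }
    where
    open State (initial p k)
    visited≢free : ∀ {i v} → free p i ≡ true → lookup (visited p) v ≡ true → v ≢ i
    visited≢free fi vv refl = contradiction (trans (sym vv) (free⁻ p fi)) λ ()
    change : ∀ {N s s′} → Section s → Section s′ → Matches (free p) s N → Matches (free p) s′ N
    change {N} {s} {s′} sec sec′ ns = record
      { involutive = involutive ns
      ; edge = λ ai Ni≢i → let aNi , e = edge ns ai Ni≢i in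
          aNi , subst₂ (Edge G) (trans (sec ai) (sym (sec′ ai))) (trans (sec aNi) (sym (sec′ aNi))) e
      }

  initial-realizes : ∀ {p k s} → State.Section (initial p k) s → State.Realizes (initial p k) s p
  initial-realizes {p} sec = record
    { at-token = refl
    ; unvisited⁻ = λ un → free⁺ p un , sec (free⁺ p un)
    ; unvisited⁺ = λ aℓ → subst (unvisited p) (sym (sec aℓ)) (free⁻ p aℓ)
    }

  initial-ClP : ∀ {p k} → Invariant (initial p k) → ClP G p
  initial-ClP inv = invariant⇒ClP (<-wellFounded _) inv (λ _ → refl) (initial-realizes λ _ → refl)

  initial-QP : ∀ {p k qs} → Invariant (initial p k) → p ∈ qs → (∀ {p′} → p′ ∈ qs → p′ ≡ p) → QP G qs
  initial-QP {p} inv p∈ only = invariant⇒QP (<-wellFounded _) inv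
    ( (λ p′∈ → id , (λ _ → refl) , subst (State.Realizes _ id) (sym (only p′∈)) (initial-realizes λ _ → refl))
    , (λ sec → p , p∈ , initial-realizes sec))

  -- Moving to an uncovered vertex

  play-matching : ∀ {p x N} → IsMatching p N → N x ≡ x → IsMatching (play p x) N
  play-matching {p} {x} {N} (ns , fix) Nx≡x =
    record
      { involutive = involutive ns
      ; edge = λ {i} ai Ni≢i →
          let i≢x , un = play-unvisited⁻ p (free⁻ (play p x) ai)
              aNi , e = edge ns (free⁺ p un) Ni≢i
          in free⁺ (play p x) (play-unvisited⁺ p
               (λ eq → i≢x (trans (sym (involutive ns i)) (trans (cong N eq) Nx≡x))) (free⁻ p aNi)) , e
      } , fix′
    where
    fix′ : FixesVisited (play p x) N
    fix′ i vi with i ≟ x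
    ... | yes refl = Nx≡x
    ... | no  i≢x  = fix i (trans (sym (lookup∘update′ i≢x (visited p) true)) vi)

  -- `N` covers neither `u` nor the visited vertex `x`, so in `p` the edge between them can be
  -- added.
  augment : ∀ {p x u N} → unvisited p x → Edge G x u → unvisited (play p x) u →
    IsMatching (play p x) N → N u ≡ u → ∃ λ N′ → IsMatching p N′ × #fixed N′ < #fixed N
  augment {p} {x} {u} {N} ux xu uu (ns , fix) Nu≡u =
    N′ , (record { involutive = involutive′ ; edge = edge′ } , fix′) ,
      count-strict fixes′ x (dec-false (N′ x ≟ x) λ eq → u≢x (trans (sym N′x≡u) eq)) (dec-true (N x ≟ x) Nx≡x)
    where
    u≢x : u ≢ x
    u≢x = proj₁ (play-unvisited⁻ p uu)
    Nx≡x : N x ≡ x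
    Nx≡x = fix x (lookup∘update x (visited p) true)
    N′ : Map n
    -- Since `N` fixes `x` and `u`, composing with the transposition pairs these two and changes
    -- nothing else.
    N′ i = transpose x u (N i)
    N′x≡u : N′ x ≡ u
    N′x≡u = trans (cong (transpose x u) Nx≡x) (transpose-left x u)
    N′u≡x : N′ u ≡ x
    N′u≡x = trans (cong (transpose x u) Nu≡u) (transpose-right x u)
    N-avoids : ∀ {i k} → N k ≡ k → i ≢ k → N i ≢ k
    N-avoids Nk≡k i≢k eq = i≢k (trans (sym (involutive ns _)) (trans (cong N eq) Nk≡k))
    N′-other : ∀ {i} → i ≢ x → i ≢ u → N′ i ≡ N i
    N′-other i≢x i≢u = transpose-fixes x u (N-avoids Nx≡x i≢x) (N-avoids Nu≡u i≢u)
    involutive′ : ∀ i → N′ (N′ i) ≡ i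
    involutive′ i = cases (i ≟ x) (i ≟ u)
      where
      cases : Dec (i ≡ x) → Dec (i ≡ u) → N′ (N′ i) ≡ i
      cases (yes refl) _ = trans (cong N′ N′x≡u) N′u≡x
      cases (no _) (yes refl) = trans (cong N′ N′u≡x) N′x≡u
      cases (no i≢x) (no i≢u) = trans (cong N′ (N′-other i≢x i≢u))
        (trans (N′-other (N-avoids Nx≡x i≢x) (N-avoids Nu≡u i≢u)) (involutive ns i))
    edge′ : ∀ {i} → free p i ≡ true → N′ i ≢ i → free p (N′ i) ≡ true × Edge G i (N′ i)
    edge′ {i} ai N′i≢i = cases (i ≟ x) (i ≟ u)
      where
      cases : Dec (i ≡ x) → Dec (i ≡ u) → free p (N′ i) ≡ true × Edge G i (N′ i)
      cases (yes refl) _ = subst (λ k → free p k ≡ true × Edge G x k) (sym N′x≡u)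
        (free⁺ p (proj₂ (play-unvisited⁻ p uu)) , xu)
      cases (no _) (yes refl) = subst (λ k → free p k ≡ true × Edge G u k) (sym N′u≡x)
        (free⁺ p ux , Edge-sym G xu)
      cases (no i≢x) (no i≢u)
        with aNi , e ← edge ns (free⁺ (play p x) (play-unvisited⁺ p i≢x (free⁻ p ai)))
                         (N′i≢i ∘ trans (N′-other i≢x i≢u)) =
          subst (λ k → free p k ≡ true × Edge G i k) (sym (N′-other i≢x i≢u))
            (free⁺ p (proj₂ (play-unvisited⁻ p (free⁻ (play p x) aNi))) , e)
    fix′ : FixesVisited p N′
    fix′ i vi = trans (N′-other i≢x i≢u) (fix i (trans (lookup∘update′ i≢x (visited p) true) vi))
      where
      i≢x : i ≢ x
      i≢x refl = contradiction (trans (sym vi) ux) λ ()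
      i≢u : i ≢ u
      i≢u refl = contradiction (trans (sym vi) (proj₂ (play-unvisited⁻ p uu))) λ ()
    fixes′ : ∀ i → fixes N′ i ≡ true → fixes N i ≡ true
    fixes′ i eq = dec-true (N i ≟ i) (cases (i ≟ x) (i ≟ u))
      where
      cases : Dec (i ≡ x) → Dec (i ≡ u) → N i ≡ i
      cases (yes refl) _ = Nx≡x
      cases (no _) (yes refl) = Nu≡u
      cases (no i≢x) (no i≢u) = trans (sym (N′-other i≢x i≢u)) (fixes-true N′ eq)

  -- Comparison of the outcomes

  outcome : ∀ p → (ClP G p × QP G (p ∷ [])) ⊎ (ClN G p × QN G (p ∷ []))
  outcome p with M , ms , maximum ← maximum-matching p
    with search
      {P = λ N → IsMatching p N × #fixed N ≡ #fixed M × ∃ λ x → Edge G (current p) x × unvisited p x × N x ≡ x}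
      (λ eq (ns , #N , x , e , un , Nx≡x) →
        IsMatching-ext {p} eq ns , trans (sym (#fixed-ext eq)) #N , x , e , un , trans (sym (eq x)) Nx≡x)
      (λ N → IsMatching? p N ×-dec (#fixed N ≟ℕ #fixed M) ×-dec any? λ x →
        (adj G (current p) x ≟B true) ×-dec (lookup (visited p) x ≟B false) ×-dec (N x ≟ x))
  ... | no all-cover = inj₁ (initial-ClP inv , initial-QP inv (here refl) λ { (here eq) → eq })
    where
    inv : Invariant (initial p (#fixed M))
    inv = initial-invariant p ms refl λ e un ns #N Nx≡x → all-cover (_ , ns , #N , _ , e , un , Nx≡x)
  ... | yes (N , ns , #N , x , e , un , Nx≡x) =
    inj₂ ( clN x f (initial-ClP inv)
         , qN (classical x) (here f)
             (initial-QP inv (∈-qApply⁺ (classical x) (here refl) (inj₁ refl) f) only))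
    where
    f : T (feasible G p x)
    f = feasible⁺ G p e un
    -- `N` misses `x`, so it is still a matching after the move, with as many fixed points. Another
    -- one with that number that missed a neighbour of `x` could be augmented in `p`, against the
    -- maximality of `M`.
    inv : Invariant (initial (play p x) (#fixed M))
    inv = initial-invariant (play p x) (play-matching {p} ns Nx≡x) #N λ {u} xu uu ns′ #N′ N′u≡u →
      let _ , better , lt = augment {p} un xu uu ns′ N′u≡u in maximum better (subst (_ <_) #N′ lt)
    only : ∀ {p′} → p′ ∈ qClassical G (p ∷ []) x → p′ ≡ play p x
    only p′∈ with _ , here refl , _ , eq ← ∈-qClassical⁻ p′∈ = eq

  ClN⇒¬ClP : ∀ {p} → ClN G p → ¬ ClP G p
  ClN⇒¬ClP (clN v f P) (clP replies) = ClN⇒¬ClP (replies v f) P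

  QN⇒¬QP : ∀ {qs} → QN G qs → ¬ QP G qs
  QN⇒¬QP (qN m legal P) (qP replies) = QN⇒¬QP (replies m legal) P

mainTheorem3 : ∀ {n : ℕ} (G : Graph n) (p : Pos n) → IsPosition p →
    (ClN G p ⇔ QN G (p ∷ [])) × (ClP G p ⇔ QP G (p ∷ []))
mainTheorem3 G p _ with outcome G p
... | inj₁ (clP-p , qP-p) =
  mk⇔ (λ clN-p → contradiction clP-p (ClN⇒¬ClP G clN-p)) (λ qN-p → contradiction qP-p (QN⇒¬QP G qN-p)) ,
  mk⇔ (const qP-p) (const clP-p)
... | inj₂ (clN-p , qN-p) =
  mk⇔ (const qN-p) (const clN-p) ,
  mk⇔ (λ clP-p → contradiction clP-p (ClN⇒¬ClP G clN-p)) (λ qP-p → contradiction qP-p (QN⇒¬QP G qN-p))
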